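{- Let $P_n$ be the path on $n\ge 3$ vertices $1,\dots,n$ with edges $e_i=\{i,i+1\}$ ($1\le i\le n-1$), let $f_j=\{j,j+2\}$ ($1\le j\le n-2$), let $B=\{e_1,f_1,e_2,f_2,\dots,e_{n-2},f_{n-2},e_{n-1}\}$ (a basis of the row space of $\mathfrak{D}_2(P_n)$), and let $\mathfrak{D}_{P_n}=\mathfrak{D}_2(P_n)[B,B]$. For $\alpha\in B$, let $\mathfrak{D}_{P_n}(\alpha|\alpha)$ be the matrix obtained from $\mathfrak{D}_{P_n}$ by deleting the row and column indexed by $\alpha$. Then $\det\mathfrak{D}_{P_n}(\alpha|\alpha)=-(n-1)$ if $\alpha$ is a pendant edge of $P_n$ (i.e. $\alpha\in\{e_1,e_{n-1}\}$), and $\det\mathfrak{D}_{P_n}(\alpha|\alpha)=-(2n-3)$ otherwise.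
   Context: For a tree $T$, let $\mathcal{V}_2$ be the set of 2-element vertex subsets (edges regarded as elements of $\mathcal{V}_2$). The 2-Steiner distance matrix $\mathfrak{D}_2(T)$ is indexed by $\mathcal{V}_2$, with entry in row $\{i,j\}$, column $\{k,l\}$ equal to the minimum number of edges of a connected subtree of $T$ whose vertex set contains $i,j,k,l$. $M[B,B]$ denotes the principal submatrix with rows and columns indexed by $B$. -}

module Defs where

open import Data.Empty using (⊥; ⊥-elim)
open import Data.Fin.Base as Fin using (Fin; zero; suc; toℕ; inject₁; punchIn)
open import Data.Fin.Properties as Fin using (toℕ-inject₁; toℕ-injective; any?; all?)
open import Data.Fin.Subset using (Subset; _∈_; _⊆_; _∪_; ⁅_⁆; ∣_∣; ⊤)
open import Data.Fin.Subset.Properties using (_∈?_; _⊆?_; anySubset?; ⊆-max; ∈⊤)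
open import Data.Integer.Base as ℤ using (ℤ; +_; -1ℤ)
import Data.Integer.Properties as ℤ
open import Data.List.Base using (List; []; _∷_; _∷ʳ_; allFin)
open import Data.List.Membership.Propositional using () renaming (_∈_ to _∈ˡ_)
open import Data.List.Membership.Propositional.Properties using (∈-allFin)
open import Data.List.Relation.Unary.All using (_∷_)
open import Data.List.Relation.Unary.AllPairs using (_∷_)
open import Data.List.Relation.Unary.Any using (here; there)
open import Data.List.Relation.Unary.Linked using (Linked; _∷_)
open import Data.List.Relation.Unary.Unique.Propositional using (Unique)
open import Data.Nat.Base using (ℕ; zero; suc; _∸_; _*_; _≤_; _<_; z≤n; s≤s; NonZero; NonTrivial)
import Data.Nat.Properties as ℕ
open import Data.Product.Base using (∃; ∃₂; ∃-syntax; _×_; _,_; proj₁; proj₂)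
open import Data.Product using (∃!)
open import Data.Sum.Base using (_⊎_; inj₁; inj₂; [_,_]′; swap)
open import Data.Vec.Functional using (Vector)
open import Function.Base using (_∘_)
open import Level using (0ℓ)
open import Relation.Binary.Construct.Closure.ReflexiveTransitive using (Star; ε; _◅_; _◅◅_; reverse)
open import Relation.Binary.Core using (Rel)
open import Relation.Binary.Definitions using (Decidable)
open import Relation.Binary.PropositionalEquality using (_≡_; refl; sym; trans; cong; subst)
open import Relation.Nullary using (¬_; Dec; yes; no)
open import Relation.Nullary.Decidable using (map′; _×-dec_; _⊎-dec_; _→-dec_)

open import Algebra.Properties.CommutativeMonoid.Sum ℤ.+-0-commutativeMonoid using (sum)

-- A 2-element subset {lo, hi} of Fin n, listed in increasing order. The order
-- proof is irrelevant, so _≡_ is equality of sets.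
record 𝒱₂ (n : ℕ) : Set where
  constructor pair
  field
    lo hi  : Fin n
    .lo<hi : lo Fin.< hi

open 𝒱₂ public

set : ∀ {n} → 𝒱₂ n → Subset n
set α = ⁅ lo α ⁆ ∪ ⁅ hi α ⁆

-- A finite simple graph on the vertices Fin n; injectivity of ends excludes
-- multiple edges, and 𝒱₂ excludes loops.
record Graph (n : ℕ) : Set where
  field
    size           : ℕ
    ends           : Fin size → 𝒱₂ n
    ends-injective : ∀ {x y} → ends x ≡ ends y → x ≡ y

Joins : ∀ {n} → 𝒱₂ n → Rel (Fin n) 0ℓ
Joins α u v = (lo α ≡ u × hi α ≡ v) ⊎ (lo α ≡ v × hi α ≡ u)

module _ {n : ℕ} (G : Graph n) where
  open Graph G

  AdjacentIn : Subset size → Rel (Fin n) 0ℓ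
  AdjacentIn E u v = ∃[ x ] x ∈ E × Joins (ends x) u v

  Adjacent : Rel (Fin n) 0ℓ
  Adjacent = AdjacentIn ⊤

  IsSubgraph : Subset n → Subset size → Set
  IsSubgraph V E = ∀ x → x ∈ E → lo (ends x) ∈ V × hi (ends x) ∈ V

  Connected : Subset n → Subset size → Set
  Connected V E = ∀ u v → u ∈ V → v ∈ V → Star (AdjacentIn E) u v

  -- The cycle u, v, w, …, u; it has at least three distinct vertices.
  IsCycle : Fin n → Fin n → Fin n → List (Fin n) → Set
  IsCycle u v w ws = Unique (u ∷ v ∷ w ∷ ws) × Linked Adjacent (u ∷ v ∷ w ∷ ws ∷ʳ u)

  Acyclic : Set
  Acyclic = ∀ u v w ws → ¬ IsCycle u v w ws

  IsLeaf : Fin n → Set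
  IsLeaf v = ∃! _≡_ (Adjacent v)

  IsPendantEdge : 𝒱₂ n → Set
  IsPendantEdge α = (∃[ x ] ends x ≡ α) × (IsLeaf (lo α) ⊎ IsLeaf (hi α))

record Tree (n : ℕ) : Set where
  field
    graph     : Graph n
    connected : Connected graph ⊤ ⊤
    acyclic   : Acyclic graph

  open Graph graph public

-- Reachability in a finite relation is decidable (Warshall's algorithm): Via vs
-- allows only intermediate vertices from vs.
module _ {n : ℕ} {R : Rel (Fin n) 0ℓ} (R? : Decidable R) where

  private
    Via : List (Fin n) → Rel (Fin n) 0ℓ
    Via []       u v = u ≡ v ⊎ R u v
    Via (w ∷ ws) u v = Via ws u v ⊎ (Via ws u w × Via ws w v)

    via? : ∀ ws → Decidable (Via ws)
    via? []       u v = (u Fin.≟ v) ⊎-dec R? u v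
    via? (w ∷ ws) u v = via? ws u v ⊎-dec (via? ws u w ×-dec via? ws w v)

    base : ∀ ws {u v} → u ≡ v ⊎ R u v → Via ws u v
    base []       p = p
    base (_ ∷ ws) p = inj₁ (base ws p)

    sound : ∀ ws {u v} → Via ws u v → Star R u v
    sound []       (inj₁ refl)    = ε
    sound []       (inj₂ r)       = r ◅ ε
    sound (_ ∷ ws) (inj₁ p)       = sound ws p
    sound (_ ∷ ws) (inj₂ (p , q)) = sound ws p ◅◅ sound ws q

    compose : ∀ ws {u w v} → w ∈ˡ ws → Via ws u w → Via ws w v → Via ws u v
    compose (_ ∷ _) (here refl) p q =
      inj₂ ([ (λ x → x) , proj₁ ]′ p , [ (λ x → x) , proj₂ ]′ q)
    compose (_ ∷ ws) (there i) (inj₁ p) (inj₁ q) = inj₁ (compose ws i p q)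
    compose (_ ∷ ws) (there i) (inj₁ p) (inj₂ (q , r)) = inj₂ (compose ws i p q , r)
    compose (_ ∷ ws) (there i) (inj₂ (p , q)) (inj₁ r) = inj₂ (p , compose ws i q r)
    compose (_ ∷ ws) (there i) (inj₂ (p , _)) (inj₂ (_ , q)) = inj₂ (p , q)

    complete : ∀ {u v} → Star R u v → Via (allFin n) u v
    complete ε        = base (allFin n) (inj₁ refl)
    complete (r ◅ rs) =
      compose (allFin n) (∈-allFin _) (base (allFin n) (inj₂ r)) (complete rs)

  star? : Decidable (Star R)
  star? u v = map′ (sound (allFin n)) complete (via? (allFin n) u v)

private
  least : ∀ {P : ℕ → Set} → (∀ k → Dec (P k)) → ∀ k → P k →
          ∃[ d ] P d × (∀ j → P j → d ≤ j)
  least P? zero    p = zero , p , λ _ _ → z≤n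
  least {P} P? (suc k) p with P? zero
  ... | yes p₀ = zero , p₀ , λ _ _ → z≤n
  ... | no ¬p₀ with least (λ j → P? (suc j)) k p
  ...   | d , pd , min = suc d , pd , λ where
            zero    q → ⊥-elim (¬p₀ q)
            (suc j) q → s≤s (min j q)

module _ {n : ℕ} (T : Tree n) where
  open Tree T

  -- A subtree of a tree is a connected subgraph; it is automatically acyclic.
  IsSubtree : Subset n → Subset size → Set
  IsSubtree V E = IsSubgraph graph V E × Connected graph V E

  HasSubtree : Subset n → ℕ → Set
  HasSubtree S k = ∃₂ λ V E → IsSubtree V E × S ⊆ V × ∣ E ∣ ≡ k

  IsSteinerDistance : Subset n → ℕ → Set
  IsSteinerDistance S d = HasSubtree S d × (∀ k → HasSubtree S k → d ≤ k)

  private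
    adjacentIn? : ∀ E → Decidable (AdjacentIn graph E)
    adjacentIn? E u v = any? λ x → (x ∈? E) ×-dec
      (((lo (ends x) Fin.≟ u) ×-dec (hi (ends x) Fin.≟ v)) ⊎-dec
       ((lo (ends x) Fin.≟ v) ×-dec (hi (ends x) Fin.≟ u)))

    isSubtree? : ∀ V E → Dec (IsSubtree V E)
    isSubtree? V E =
      (all? λ x → (x ∈? E) →-dec ((lo (ends x) ∈? V) ×-dec (hi (ends x) ∈? V)))
      ×-dec
      (all? λ u → all? λ v → (u ∈? V) →-dec ((v ∈? V) →-dec star? (adjacentIn? E) u v))

    hasSubtree? : ∀ S k → Dec (HasSubtree S k)
    hasSubtree? S k = anySubset? λ V → anySubset? λ E →
      isSubtree? V E ×-dec ((S ⊆? V) ×-dec (∣ E ∣ ℕ.≟ k))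

  steiner : ∀ S → ∃ (IsSteinerDistance S)
  steiner S = least (hasSubtree? S) ∣ ⊤ {size} ∣
    (⊤ , ⊤ , ((λ _ _ → ∈⊤ , ∈⊤) , connected) , ⊆-max S , refl)

  steinerDistance : Subset n → ℕ
  steinerDistance S = proj₁ (steiner S)

  𝔇₂ : 𝒱₂ n → 𝒱₂ n → ℤ
  𝔇₂ α β = + steinerDistance (set α ∪ set β)

Matrix : Set → ℕ → Set
Matrix A k = Fin k → Fin k → A

-- M [ b , b ] for a list b of row and column indices.
principal : ∀ {I A : Set} {k} → (I → I → A) → Vector I k → Matrix A k
principal M b i j = M (b i) (b j)

deleteRowCol : ∀ {A : Set} {k} → Fin (suc k) → Fin (suc k) → Matrix A (suc k) → Matrix A k
deleteRowCol r c M i j = M (punchIn r i) (punchIn c j)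

-- Laplace expansion along the first row.
det : ∀ {k} → Matrix ℤ k → ℤ
det {zero}  M = + 1
det {suc k} M =
  sum λ j → (-1ℤ ℤ.^ toℕ j) ℤ.* M zero j ℤ.* det (deleteRowCol zero j M)

-- Vertices and indices are counted from 0: vertex i of P n is the element i - 1
-- of Fin n, and e_i, f_j are e n (i - 1), f n (j - 1).
e : ∀ n .{{_ : NonZero n}} → Fin (n ∸ 1) → 𝒱₂ n
e (suc m) i = pair (inject₁ i) (suc i) (s≤s (ℕ.≤-reflexive (toℕ-inject₁ i)))

f : ∀ n .{{_ : NonTrivial n}} → Fin (n ∸ 2) → 𝒱₂ n
f (suc (suc m)) j = pair (inject₁ (inject₁ j)) (suc (suc j))
  (s≤s (ℕ.m≤n⇒m≤1+n (ℕ.≤-reflexive (trans (toℕ-inject₁ (inject₁ j)) (toℕ-inject₁ j)))))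

pathGraph : ∀ n .{{_ : NonZero n}} → Graph n
pathGraph n@(suc m) = record
  { size           = m
  ; ends           = e n
  ; ends-injective = λ eq → Fin.suc-injective (cong hi eq)
  }

private
  Next : ∀ {n} → Rel (Fin n) 0ℓ
  Next u v = toℕ v ≡ suc (toℕ u)

  step : ∀ m {u v} → Adjacent (pathGraph (suc m)) u v → Next u v ⊎ Next v u
  step m (x , _ , inj₁ (refl , refl)) = inj₁ (cong suc (sym (toℕ-inject₁ x)))
  step m (x , _ , inj₂ (refl , refl)) = inj₂ (cong suc (sym (toℕ-inject₁ x)))

  symmetric : ∀ m {u v} → Adjacent (pathGraph (suc m)) u v → Adjacent (pathGraph (suc m)) v u
  symmetric m (x , x∈ , j) = x , x∈ , swap j

  fromZero : ∀ m v → Star (Adjacent (pathGraph (suc m))) zero v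
  fromZero m       zero    = ε
  fromZero (suc m) (suc v) = (zero , ∈⊤ , inj₁ (refl , refl)) ◅ shift (fromZero m v)
    where
    shift : ∀ {u w} → Star (Adjacent (pathGraph (suc m))) u w →
            Star (Adjacent (pathGraph (suc (suc m)))) (suc u) (suc w)
    shift ε = ε
    shift ((x , _ , inj₁ (refl , refl)) ◅ p) =
      (suc x , ∈⊤ , inj₁ (refl , refl)) ◅ shift p
    shift ((x , _ , inj₂ (refl , refl)) ◅ p) =
      (suc x , ∈⊤ , inj₂ (refl , refl)) ◅ shift p

  pathConnected : ∀ m → Connected (pathGraph (suc m)) ⊤ ⊤
  pathConnected m u v _ _ = reverse (symmetric m) (fromZero m u) ◅◅ fromZero m v

  same-pred : ∀ {n} {a b c : Fin n} → Next a b → Next c b → a ≡ c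
  same-pred p q = toℕ-injective (ℕ.suc-injective (trans (sym p) q))

  same-succ : ∀ {n} {a b c : Fin n} → Next a b → Next a c → b ≡ c
  same-succ p q = toℕ-injective (trans p (sym q))

  ascending : ∀ m u a b cs → toℕ u < toℕ a → Next a b → Unique (a ∷ b ∷ cs) →
              Linked (Adjacent (pathGraph (suc m))) (b ∷ cs ∷ʳ u) → ⊥
  ascending m u a b [] u<a ab _ (bu ∷ _) with step m bu
  ... | inj₁ p = ℕ.<-asym u<a (subst (toℕ a <_) (sym p) (ℕ.m≤n⇒m≤1+n (ℕ.≤-reflexive (sym ab))))
  ... | inj₂ p = ℕ.<-irrefl (cong toℕ (same-pred p ab)) u<a
  ascending m u a b (c ∷ cs) u<a ab ((_ ∷ a≢c ∷ _) ∷ uniq) (bc ∷ link) with step m bc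
  ... | inj₁ p = ascending m u b c cs (ℕ.<-trans u<a (ℕ.≤-reflexive (sym ab))) p uniq link
  ... | inj₂ p = a≢c (same-pred ab p)

  descending : ∀ m u a b cs → toℕ a < toℕ u → Next b a → Unique (a ∷ b ∷ cs) →
               Linked (Adjacent (pathGraph (suc m))) (b ∷ cs ∷ʳ u) → ⊥
  descending m u a b [] a<u ba _ (bu ∷ _) with step m bu
  ... | inj₁ p = ℕ.<-irrefl (cong toℕ (same-succ ba p)) a<u
  ... | inj₂ p = ℕ.<-asym a<u (ℕ.<-trans (ℕ.≤-reflexive (sym p)) (ℕ.≤-reflexive (sym ba)))
  descending m u a b (c ∷ cs) a<u ba ((_ ∷ a≢c ∷ _) ∷ uniq) (bc ∷ link) with step m bc
  ... | inj₁ p = a≢c (same-succ ba p)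
  ... | inj₂ p = descending m u b c cs (ℕ.<-trans (ℕ.≤-reflexive (sym ba)) a<u) p uniq link

  pathAcyclic : ∀ m → Acyclic (pathGraph (suc m))
  pathAcyclic m u v w ws ((_ ∷ u≢w ∷ _) ∷ uniq , uv ∷ vw ∷ link)
    with step m uv | step m vw
  ... | inj₁ p | inj₁ q = ascending m u v w ws (ℕ.≤-reflexive (sym p)) q uniq link
  ... | inj₁ p | inj₂ q = u≢w (same-pred p q)
  ... | inj₂ p | inj₁ q = u≢w (same-succ p q)
  ... | inj₂ p | inj₂ q = descending m u v w ws (ℕ.≤-reflexive (sym p)) q uniq link

P : ∀ n .{{_ : NonZero n}} → Tree n
P n@(suc m) = record
  { graph     = pathGraph n
  ; connected = pathConnected m
  ; acyclic   = pathAcyclic m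
  }

interleave : ∀ {A : Set} {m} → Vector A (suc m) → Vector A m → Vector A (suc (m * 2))
interleave             x y zero          = x zero
interleave {m = suc m} x y (suc zero)    = y zero
interleave {m = suc m} x y (suc (suc i)) = interleave (x ∘ suc) (y ∘ suc) i

-- e_1, f_1, e_2, f_2, …, e_{n-2}, f_{n-2}, e_{n-1}.
B : ∀ n .{{_ : NonTrivial n}} → Vector (𝒱₂ n) (suc ((n ∸ 2) * 2))
B n@(suc (suc m)) = interleave (e n) (f n)

𝔇P : ∀ n .{{_ : NonTrivial n}} → Matrix ℤ (suc ((n ∸ 2) * 2))
𝔇P n@(suc (suc m)) = principal (𝔇₂ (P n)) (B n)

{-# OPTIONS --safe #-}

-- On a path the Steiner distance of a set is its largest vertex minus its
-- smallest one. Along B both end points increase weakly, so every principal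
-- submatrix M of 𝔇P has entries M s t = h (s ⊔ t) − l (s ⊓ t). Subtracting from
-- each row, then from each column, its predecessor leaves an arrowhead matrix:
-- corner h₀ − l₀, border the increments of h, and diagonal minus the sum of the
-- increments of h and l. Consecutive members of B give diagonal entries −1; an
-- inner deletion merges two steps into a single entry −2.
module Submission where

open import Defs
open import Algebra.Properties.Semiring.Sum using (*-distribˡ-sum)
open import Data.Fin.Base as Fin using (Fin; zero; suc; toℕ; fromℕ; inject₁; punchIn)
open import Data.Fin.Properties as Fin using (toℕ-inject₁; toℕ-injective; toℕ<n; toℕ-fromℕ)
open import Data.Fin.Subset using (Subset; inside; outside; _∈_; _⊆_; _∪_; ⁅_⁆; ∣_∣)
open import Data.Fin.Subset.Properties using (x∈p∪q⁺; x∈p∪q⁻; x∈⁅x⁆; x∈⁅y⁆⇒x≡y; p⊆q⇒∣p∣≤∣q∣; ∈⊤)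
open import Data.Integer.Base as ℤ using (ℤ; +_; -_; 0ℤ; 1ℤ; -1ℤ)
import Data.Integer.Properties as ℤ
open import Data.Integer.Solver using (module +-*-Solver)
open import Data.Nat.Base as ℕ using (ℕ; zero; suc; _+_; _*_; _∸_; _≤_; _<_; z≤n; s≤s; ⌊_/2⌋; ⌈_/2⌉)
import Data.Nat.Properties as ℕ
open import Data.Product.Base using (_×_; _,_; proj₁; proj₂)
open import Data.Sum.Base using (_⊎_; inj₁; inj₂; [_,_]′; swap)
open import Data.Vec.Base using ([]; _∷_; here; there)
open import Data.Vec.Functional using (Vector)
open import Function.Base using (_∘_; flip)
open import Relation.Binary.Construct.Closure.ReflexiveTransitive using (Star; ε; _◅_; _◅◅_; reverse)
open import Relation.Binary.Definitions using (tri<; tri≈; tri>)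
open import Relation.Binary.PropositionalEquality using (_≡_; _≢_; _≗_; refl; sym; trans; cong; cong₂; subst; subst₂; module ≡-Reasoning)
open import Relation.Nullary using (¬_; contradiction; yes; no)

open import Algebra.Properties.CommutativeMonoid.Sum ℤ.+-0-commutativeMonoid using (sum; sum-cong-≗; ∑-comm; ∑-distrib-+; sum-replicate-zero)

open +-*-Solver using (solve; con; _:=_; _:+_; _:*_; _:-_; :-_)

private
  variable
    k m n : ℕ

-- Determinants

sgn : Fin k → ℤ
sgn i = -1ℤ ℤ.^ toℕ i

sum-zero : {t : Vector ℤ k} → (∀ i → t i ≡ 0ℤ) → sum t ≡ 0ℤ
sum-zero {k} t≡0 = trans (sum-cong-≗ t≡0) (sum-replicate-zero k)

*-sum : ∀ c (t : Vector ℤ k) → c ℤ.* sum t ≡ sum (λ i → c ℤ.* t i)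
*-sum = *-distribˡ-sum ℤ.+-*-semiring

cofactorTerm : Matrix ℤ (suc k) → Vector ℤ (suc k)
cofactorTerm M j = sgn j ℤ.* M zero j ℤ.* det (deleteRowCol zero j M)

det-cong : {M N : Matrix ℤ k} → (∀ i j → M i j ≡ N i j) → det M ≡ det N
det-cong {zero}  M≗N = refl
det-cong {suc k} M≗N = sum-cong-≗ λ j →
  cong₂ (λ x y → sgn j ℤ.* x ℤ.* y) (M≗N zero j) (det-cong λ a b → M≗N (suc a) (punchIn j b))

-- The extra factor `-1ℤ` turns `sgn j` into the sign of column `suc j` in the bordered matrix.
borderTerm : Matrix ℤ (suc k) → Vector ℤ (suc k) → Vector ℤ (suc k) → Matrix ℤ (suc k)
borderTerm M v u i j = (sgn i ℤ.* v i) ℤ.* ((-1ℤ ℤ.* sgn j) ℤ.* u j ℤ.* det (deleteRowCol i j M))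

-- The correction term for bordering M by the column v and the row u:
-- it equals − uᵀ adj(M) v.
border : Matrix ℤ k → Vector ℤ k → Vector ℤ k → ℤ
border {zero}  M v u = 0ℤ
border {suc k} M v u = sum λ i → sum (borderTerm M v u i)

inner : Matrix ℤ (suc k) → Matrix ℤ k
inner = deleteRowCol zero zero

-- Expand along the first row, and every minor except the first along its first column, which is
-- what remains of column `zero`. This uses `det-column` one size down, while `det-column` uses this
-- lemma at its own size; hence the joint induction.
det-bordered : (M : Matrix ℤ (suc k)) →
  det M ≡ M zero zero ℤ.* det (inner M) ℤ.+ border (inner M) (λ i → M (suc i) zero) (λ j → M zero (suc j))

-- Grouping the double sum of `det-bordered` by rows turns each group into the first-row expansion
-- of the minor at `suc i`, `zero`.
det-column : (M : Matrix ℤ (suc k)) →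
  det M ≡ sum λ i → sgn i ℤ.* M i zero ℤ.* det (deleteRowCol i zero M)

det-bordered {zero}  M = cong (λ x → x ℤ.* 1ℤ ℤ.+ 0ℤ) (ℤ.*-identityˡ (M zero zero))
det-bordered {suc k} M = cong₂ ℤ._+_
  (cong (ℤ._* det (inner M)) (ℤ.*-identityˡ (M zero zero)))
  (trans (sum-cong-≗ expand) (∑-comm (flip t)))
  where
  t = borderTerm (inner M) (λ i → M (suc i) zero) (λ j → M zero (suc j))
  expand : ∀ j → cofactorTerm M (suc j) ≡ sum (λ i → t i j)
  expand j = trans
    (cong (c ℤ.*_) (det-column (deleteRowCol zero (suc j) M)))
    (trans (*-sum c s) (sum-cong-≗ {x = λ i → c ℤ.* s i} λ i →
      solve 3 (λ x y z → x :* (y :* z) := y :* (x :* z)) refl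
        c (sgn i ℤ.* M (suc i) zero) (det (deleteRowCol i j (inner M)))))
    where
    c = (-1ℤ ℤ.* sgn j) ℤ.* M zero (suc j)
    s : Vector ℤ (suc k)
    s i = sgn i ℤ.* M (suc i) zero ℤ.* det (deleteRowCol i j (inner M))

det-column {zero}  M = refl
det-column {suc k} M = trans (det-bordered M) (cong₂ ℤ._+_
  (cong (ℤ._* det (inner M)) (sym (ℤ.*-identityˡ (M zero zero))))
  (sum-cong-≗ collect))
  where
  t = borderTerm (inner M) (λ i → M (suc i) zero) (λ j → M zero (suc j))
  collect : ∀ i → sum (t i) ≡ (-1ℤ ℤ.* sgn i) ℤ.* M (suc i) zero ℤ.* det (deleteRowCol (suc i) zero M)
  collect i = trans
    (sum-cong-≗ {x = t i} {λ j → c ℤ.* s j} λ j →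
      solve 5 (λ s v t u d → (s :* v) :* ((con -1ℤ :* t) :* u :* d) := (con -1ℤ :* s) :* v :* (t :* u :* d)) refl
        (sgn i) (M (suc i) zero) (sgn j) (M zero (suc j)) (det (deleteRowCol i j (inner M))))
    (sym (*-sum c s))
    where
    c = (-1ℤ ℤ.* sgn i) ℤ.* M (suc i) zero
    s = cofactorTerm (deleteRowCol (suc i) zero M)

det-transpose : (M : Matrix ℤ k) → det (flip M) ≡ det M
det-transpose {zero}  M = refl
det-transpose {suc k} M = trans
  (sum-cong-≗ λ j → cong (sgn j ℤ.* M j zero ℤ.*_) (det-transpose (deleteRowCol j zero M)))
  (sym (det-column M))

-- The first two cofactor terms cancel, because deleting either of the equal columns leaves the same
-- minor and the signs differ. Every later minor retains both columns and vanishes by induction.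
det-equalColumns : (M : Matrix ℤ (suc (suc k))) → (∀ i → M i zero ≡ M i (suc zero)) → det M ≡ 0ℤ
det-equalColumns {k} M eq = begin
  t₀ ℤ.+ (t₁ ℤ.+ sum rest)                   ≡⟨ cong (λ x → t₀ ℤ.+ (t₁ ℤ.+ x)) (sum-zero (rest≡0 M eq)) ⟩
  t₀ ℤ.+ (t₁ ℤ.+ 0ℤ)                         ≡⟨ cong₂ (λ x y → 1ℤ ℤ.* x ℤ.* y ℤ.+ (t₁ ℤ.+ 0ℤ)) (eq zero) (det-cong same) ⟩
  1ℤ ℤ.* c ℤ.* d ℤ.+ (t₁ ℤ.+ 0ℤ)             ≡⟨ solve 2 (λ m d → con 1ℤ :* m :* d :+ (con -1ℤ :* m :* d :+ con 0ℤ) := con 0ℤ) refl c d ⟩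
  0ℤ                                         ∎
  where
  open ≡-Reasoning
  c = M zero (suc zero)
  d = det (deleteRowCol zero (suc zero) M)
  t₀ = 1ℤ ℤ.* M zero zero ℤ.* det (inner M)
  t₁ = -1ℤ ℤ.* c ℤ.* d
  rest : Vector ℤ k
  rest j = cofactorTerm M (suc (suc j))
  rest≡0 : ∀ {k} (M : Matrix ℤ (suc (suc k))) → (∀ i → M i zero ≡ M i (suc zero)) → ∀ j →
    cofactorTerm M (suc (suc j)) ≡ 0ℤ
  rest≡0 {suc k} M eq j = trans
    (cong (sgn (suc (suc j)) ℤ.* M zero (suc (suc j)) ℤ.*_) (det-equalColumns (deleteRowCol zero (suc (suc j)) M) (eq ∘ suc)))
    (ℤ.*-zeroʳ (sgn (suc (suc j)) ℤ.* M zero (suc (suc j))))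
  same : ∀ a b → inner M a b ≡ deleteRowCol zero (suc zero) M a b
  same a zero    = sym (eq (suc a))
  same a (suc b) = refl

det-equalRows : (M : Matrix ℤ (suc (suc k))) → (∀ j → M zero j ≡ M (suc zero) j) → det M ≡ 0ℤ
det-equalRows M eq = trans (sym (det-transpose M)) (det-equalColumns (flip M) eq)

sum-minus : (s t : Vector ℤ k) → sum (λ i → s i ℤ.- t i) ≡ sum s ℤ.- sum t
sum-minus s t = trans (∑-distrib-+ s (λ i → - t i)) (cong (λ x → sum s ℤ.+ x) (begin
  sum (λ i → - t i)         ≡⟨ sum-cong-≗ (λ i → sym (ℤ.-1*i≡-i (t i))) ⟩
  sum (λ i → -1ℤ ℤ.* t i)   ≡⟨ *-sum -1ℤ t ⟨
  -1ℤ ℤ.* sum t             ≡⟨ ℤ.-1*i≡-i (sum t) ⟩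
  - sum t                   ∎))
  where open ≡-Reasoning

-- For the first row the minors of all three matrices agree; for a later row the first rows agree
-- and the minors satisfy the same hypotheses.
det-row-minus : (r : Fin (suc k)) (L M N : Matrix ℤ (suc k)) →
  (∀ j → L r j ≡ M r j ℤ.- N r j) →
  (∀ i j → L (punchIn r i) j ≡ M (punchIn r i) j) →
  (∀ i j → L (punchIn r i) j ≡ N (punchIn r i) j) →
  det L ≡ det M ℤ.- det N
det-row-minus {k} zero L M N Lr LM LN = trans (sum-cong-≗ term) (sum-minus (cofactorTerm M) (cofactorTerm N))
  where
  term : ∀ j → cofactorTerm L j ≡ cofactorTerm M j ℤ.- cofactorTerm N j
  term j rewrite Lr j
    | sym (det-cong {M = deleteRowCol zero j L} {deleteRowCol zero j M} λ a b → LM a (punchIn j b))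
    | sym (det-cong {M = deleteRowCol zero j L} {deleteRowCol zero j N} λ a b → LN a (punchIn j b)) =
    solve 4 (λ s m n d → s :* (m :- n) :* d := s :* m :* d :- s :* n :* d) refl
      (sgn j) (M zero j) (N zero j) (det (deleteRowCol zero j L))
det-row-minus {suc k} (suc r) L M N Lr LM LN = trans (sum-cong-≗ term) (sum-minus (cofactorTerm M) (cofactorTerm N))
  where
  term : ∀ j → cofactorTerm L j ≡ cofactorTerm M j ℤ.- cofactorTerm N j
  term j rewrite sym (LM zero j) | sym (LN zero j)
    | det-row-minus r (deleteRowCol zero j L) (deleteRowCol zero j M) (deleteRowCol zero j N)
        (λ b → Lr (punchIn j b)) (λ a b → LM (suc a) (punchIn j b)) (λ a b → LN (suc a) (punchIn j b)) =
    solve 4 (λ s l m n → s :* l :* (m :- n) := s :* l :* m :- s :* l :* n) refl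
      (sgn j) (L zero j) (det (deleteRowCol zero j M)) (det (deleteRowCol zero j N))

rowΔ : Matrix ℤ (suc k) → Matrix ℤ (suc k)
rowΔ M zero    j = M zero j
rowΔ M (suc i) j = M (suc i) j ℤ.- M (inject₁ i) j

-- Linearity splits row one, and the subtracted matrix `C` has two equal rows. In `N`, rows zero and
-- one are those of `M`, so each first-row minor of `N` is `rowΔ` of the corresponding minor of `M`,
-- where the induction applies.
det-rowΔ : (M : Matrix ℤ (suc k)) → det (rowΔ M) ≡ det M
det-rowΔ {zero}  M = det-cong {M = rowΔ M} {M} λ { zero j → refl }
det-rowΔ {suc k} M = begin
  det (rowΔ M)       ≡⟨ det-row-minus (suc zero) (rowΔ M) N C (λ _ → refl) onN onC ⟩
  det N ℤ.- det C    ≡⟨ cong (λ x → det N ℤ.- x) (det-equalRows C λ _ → refl) ⟩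
  det N ℤ.- 0ℤ       ≡⟨ ℤ.+-identityʳ (det N) ⟩
  det N              ≡⟨ sum-cong-≗ (λ j → cong (sgn j ℤ.* M zero j ℤ.*_) (minorN j)) ⟩
  det M              ∎
  where
  open ≡-Reasoning
  N C : Matrix ℤ (suc (suc k))
  N zero          = M zero
  N (suc zero)    = M (suc zero)
  N (suc (suc i)) = rowΔ M (suc (suc i))
  C zero          = M zero
  C (suc zero)    = M zero
  C (suc (suc i)) = rowΔ M (suc (suc i))
  onN : ∀ i j → rowΔ M (punchIn (suc zero) i) j ≡ N (punchIn (suc zero) i) j
  onN zero    j = refl
  onN (suc i) j = refl
  onC : ∀ i j → rowΔ M (punchIn (suc zero) i) j ≡ C (punchIn (suc zero) i) j
  onC zero    j = refl
  onC (suc i) j = refl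
  minorN : ∀ j → det (deleteRowCol zero j N) ≡ det (deleteRowCol zero j M)
  minorN j = trans (det-cong {M = deleteRowCol zero j N} {rowΔ (deleteRowCol zero j M)} λ { zero b → refl ; (suc a) b → refl }) (det-rowΔ (deleteRowCol zero j M))

det-firstRow : (M : Matrix ℤ (suc k)) → (∀ j → M zero (suc j) ≡ 0ℤ) → det M ≡ M zero zero ℤ.* det (inner M)
det-firstRow M row≡0 = trans
  (cong₂ ℤ._+_ (cong (ℤ._* det (inner M)) (ℤ.*-identityˡ (M zero zero))) (sum-zero λ j →
    trans (cong (λ x → (-1ℤ ℤ.* sgn j) ℤ.* x ℤ.* det (deleteRowCol zero (suc j) M)) (row≡0 j))
      (cong (ℤ._* det (deleteRowCol zero (suc j) M)) (ℤ.*-zeroʳ (-1ℤ ℤ.* sgn j)))))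
  (ℤ.+-identityʳ _)

det-zeroRow : (M : Matrix ℤ (suc k)) → (∀ j → M zero j ≡ 0ℤ) → det M ≡ 0ℤ
det-zeroRow M row≡0 = trans (det-firstRow M (row≡0 ∘ suc)) (cong (ℤ._* det (inner M)) (row≡0 zero))

det-zeroColumn : (M : Matrix ℤ (suc k)) → (∀ i → M i zero ≡ 0ℤ) → det M ≡ 0ℤ
det-zeroColumn M col≡0 = trans (sym (det-transpose M)) (det-zeroRow (flip M) col≡0)

-- Diagonal matrices and their borders

IsDiagonal : Matrix ℤ k → Vector ℤ k → Set
IsDiagonal M d = (∀ i → M i i ≡ d i) × (∀ i j → i ≢ j → M i j ≡ 0ℤ)

inner-isDiagonal : {M : Matrix ℤ (suc k)} {d : Vector ℤ (suc k)} → IsDiagonal M d → IsDiagonal (inner M) (d ∘ suc)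
inner-isDiagonal (on , off) = on ∘ suc , λ i j i≢j → off (suc i) (suc j) (i≢j ∘ Fin.suc-injective)

product : Vector ℤ k → ℤ
product {zero}  d = 1ℤ
product {suc k} d = d zero ℤ.* product (d ∘ suc)

det-diagonal : {M : Matrix ℤ k} {d : Vector ℤ k} → IsDiagonal M d → det M ≡ product d
det-diagonal {zero}  diag = refl
det-diagonal {suc k} {M} diag@(on , off) = trans
  (det-firstRow M λ j → off zero (suc j) λ ())
  (cong₂ ℤ._*_ (on zero) (det-diagonal (inner-isDiagonal diag)))

-- − ∑ᵢ xᵢ² ∏_{j ≠ i} dⱼ
arrow : Vector ℤ k → Vector ℤ k → ℤ
arrow {zero}  x d = 0ℤ
arrow {suc k} x d = - (x zero ℤ.* x zero ℤ.* product (d ∘ suc)) ℤ.+ d zero ℤ.* arrow (x ∘ suc) (d ∘ suc)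

-- A minor that loses row or column `zero` but not both has a zero column or row. This leaves one
-- term in `first`; in `others` the factor `d zero` comes out of every remaining minor, and the
-- recursion takes over.
border-diagonal : {M : Matrix ℤ k} {d : Vector ℤ k} (x : Vector ℤ k) → IsDiagonal M d → border M x x ≡ arrow x d
border-diagonal {zero}          x diag = refl
border-diagonal {suc k} {M} {d} x diag@(on , off) = cong₂ ℤ._+_ first (others M d x diag)
  where
  vanish : ∀ a b {c} → c ≡ 0ℤ → a ℤ.* (b ℤ.* c) ≡ 0ℤ
  vanish a b refl = solve 2 (λ a b → a :* (b :* con 0ℤ) := con 0ℤ) refl a b

  topMinor : ∀ {k} (M : Matrix ℤ (suc k)) {d} → IsDiagonal M d → ∀ j → det (deleteRowCol zero (suc j) M) ≡ 0ℤ
  topMinor {suc k} M (_ , off) j = det-zeroColumn (deleteRowCol zero (suc j) M) λ i → off (suc i) zero λ ()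

  leftMinor : ∀ {k} (M : Matrix ℤ (suc k)) {d} → IsDiagonal M d → ∀ i → det (deleteRowCol (suc i) zero M) ≡ 0ℤ
  leftMinor {suc k} M (_ , off) i = det-zeroRow (deleteRowCol (suc i) zero M) λ j → off zero (suc j) λ ()

  first : sum (borderTerm M x x zero) ≡ - (x zero ℤ.* x zero ℤ.* product (d ∘ suc))
  first = begin
    borderTerm M x x zero zero ℤ.+ sum (borderTerm M x x zero ∘ suc)
      ≡⟨ cong (λ y → borderTerm M x x zero zero ℤ.+ y) (sum-zero λ j → vanish (1ℤ ℤ.* x zero) ((-1ℤ ℤ.* sgn (suc j)) ℤ.* x (suc j)) (topMinor M diag j)) ⟩
    borderTerm M x x zero zero ℤ.+ 0ℤ
      ≡⟨ solve 2 (λ y m → (con 1ℤ :* y) :* ((con -1ℤ :* con 1ℤ) :* y :* m) :+ con 0ℤ := :- (y :* y :* m)) refl (x zero) (det (inner M)) ⟩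
    - (x zero ℤ.* x zero ℤ.* det (inner M))
      ≡⟨ cong (λ m → - (x zero ℤ.* x zero ℤ.* m)) (det-diagonal (inner-isDiagonal diag)) ⟩
    - (x zero ℤ.* x zero ℤ.* product (d ∘ suc)) ∎
    where open ≡-Reasoning

  others : ∀ {k} (M : Matrix ℤ (suc k)) d x → IsDiagonal M d →
    sum (λ i → sum (borderTerm M x x (suc i))) ≡ d zero ℤ.* arrow (x ∘ suc) (d ∘ suc)
  others {zero}  M d x diag = sym (ℤ.*-zeroʳ (d zero))
  others {suc k} M d x diag@(on , off) = begin
    sum (λ i → sum (borderTerm M x x (suc i)))
      ≡⟨ sum-cong-≗ row ⟩
    sum (λ i → d zero ℤ.* sum (t i))
      ≡⟨ *-sum (d zero) (λ i → sum (t i)) ⟨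
    d zero ℤ.* border (inner M) (x ∘ suc) (x ∘ suc)
      ≡⟨ cong (d zero ℤ.*_) (border-diagonal (x ∘ suc) (inner-isDiagonal diag)) ⟩
    d zero ℤ.* arrow (x ∘ suc) (d ∘ suc) ∎
    where
    open ≡-Reasoning
    t = borderTerm (inner M) (x ∘ suc) (x ∘ suc)
    pull : ∀ i j → borderTerm M x x (suc i) (suc j) ≡ d zero ℤ.* t i j
    -- Beyond the corner `d zero` the first row of this minor is zero. The two signs gained from
    -- `suc i` and `suc j` cancel.
    pull i j rewrite det-firstRow (deleteRowCol (suc i) (suc j) M) (λ b → off zero (suc (punchIn j b)) λ ()) | on zero =
      solve 6 (λ s t y z c m → ((con -1ℤ :* s) :* y) :* ((con -1ℤ :* (con -1ℤ :* t)) :* z :* (c :* m)) := c :* ((s :* y) :* ((con -1ℤ :* t) :* z :* m))) refl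
        (sgn i) (sgn j) (x (suc i)) (x (suc j)) (d zero) (det (deleteRowCol i j (inner M)))
    row : ∀ i → sum (borderTerm M x x (suc i)) ≡ d zero ℤ.* sum (t i)
    row i = begin
      borderTerm M x x (suc i) zero ℤ.+ sum (λ j → borderTerm M x x (suc i) (suc j))
        ≡⟨ cong₂ ℤ._+_ (vanish (sgn (suc i) ℤ.* x (suc i)) ((-1ℤ ℤ.* 1ℤ) ℤ.* x zero) (leftMinor M diag i)) (sum-cong-≗ (pull i)) ⟩
      0ℤ ℤ.+ sum (λ j → d zero ℤ.* t i j)
        ≡⟨ ℤ.+-identityˡ _ ⟩
      sum (λ j → d zero ℤ.* t i j)
        ≡⟨ *-sum (d zero) (t i) ⟨
      d zero ℤ.* sum (t i) ∎

-- Span matrices and their reduction to arrowhead form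

Δ : Vector ℤ (suc k) → Vector ℤ k
Δ h i = h (suc i) ℤ.- h (inject₁ i)

-- M s t = h (s ⊔ t) − l (s ⊓ t)
IsSpan : (h l : Vector ℤ k) → Matrix ℤ k → Set
IsSpan h l M = (∀ {s t} → toℕ s ≤ toℕ t → M s t ≡ h t ℤ.- l s) × (∀ {s t} → toℕ t ≤ toℕ s → M s t ≡ h s ℤ.- l t)

-- Applying `rowΔ` twice with a transposition in between differences rows and columns. Along the
-- first row and column `l zero` cancels, which leaves the border `Δ h`.
det-span : {h l : Vector ℤ (suc k)} {M : Matrix ℤ (suc k)} → IsSpan h l M →
  let d = λ i → - (Δ h i ℤ.+ Δ l i) in
  det M ≡ (h zero ℤ.- l zero) ℤ.* product d ℤ.+ arrow (Δ h) d
det-span {k} {h} {l} {M} (upper , lower) = begin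
  det M                        ≡⟨ det-rowΔ M ⟨
  det (rowΔ M)                 ≡⟨ det-transpose (rowΔ M) ⟨
  det (flip (rowΔ M))          ≡⟨ det-rowΔ (flip (rowΔ M)) ⟨
  det A                        ≡⟨ det-cong A≗A′ ⟩
  det A′                       ≡⟨ det-bordered A′ ⟩
  (h zero ℤ.- l zero) ℤ.* det D ℤ.+ border D (Δ h) (Δ h)
                               ≡⟨ cong₂ (λ x y → (h zero ℤ.- l zero) ℤ.* x ℤ.+ y) (det-diagonal diag) (border-diagonal (Δ h) diag) ⟩
  (h zero ℤ.- l zero) ℤ.* product d ℤ.+ arrow (Δ h) d ∎
  where
  open ≡-Reasoning
  d : Vector ℤ k
  d i = - (Δ h i ℤ.+ Δ l i)
  A A′ : Matrix ℤ (suc k)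
  A = rowΔ (flip (rowΔ M))
  D : Matrix ℤ k
  D = inner A
  -- `A′` puts only the first row and column of `A` in closed form, so that `det-bordered` yields
  -- the border `Δ h` definitionally.
  A′ zero    zero    = h zero ℤ.- l zero
  A′ zero    (suc t) = Δ h t
  A′ (suc s) zero    = Δ h s
  A′ (suc s) (suc t) = D s t

  ≤suc : (t : Fin k) → toℕ (inject₁ t) ≤ suc (toℕ t)
  ≤suc t = ℕ.m≤n⇒m≤1+n (ℕ.≤-reflexive (toℕ-inject₁ t))

  A≗A′ : ∀ s t → A s t ≡ A′ s t
  A≗A′ zero    zero    = upper z≤n
  A≗A′ zero    (suc t) = trans (cong₂ ℤ._-_ (lower z≤n) (lower z≤n))
    (solve 3 (λ a b c → (a :- c) :- (b :- c) := a :- b) refl (h (suc t)) (h (inject₁ t)) (l zero))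
  A≗A′ (suc s) zero    = trans (cong₂ ℤ._-_ (upper z≤n) (upper z≤n))
    (solve 3 (λ a b c → (a :- c) :- (b :- c) := a :- b) refl (h (suc s)) (h (inject₁ s)) (l zero))
  A≗A′ (suc s) (suc t) = refl

  diag : IsDiagonal D d
  diag = on , off
    where
    on : ∀ i → D i i ≡ d i
    on i rewrite upper {suc i} {suc i} ℕ.≤-refl | upper {inject₁ i} {suc i} (≤suc i)
      | lower {suc i} {inject₁ i} (≤suc i) | upper {inject₁ i} {inject₁ i} ℕ.≤-refl =
      solve 4 (λ a b c e → (a :- c) :- (a :- e) :- ((a :- e) :- (b :- e)) := :- ((a :- b) :+ (c :- e))) refl
        (h (suc i)) (h (inject₁ i)) (l (suc i)) (l (inject₁ i))
    -- Off the diagonal the four entries involved fall under the same case of `IsSpan`, where an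
    -- entry is a function of one index minus a function of the other. A mixed second difference
    -- kills both parts.
    off : ∀ i j → i ≢ j → D i j ≡ 0ℤ
    off i j i≢j with ℕ.<-cmp (toℕ i) (toℕ j)
    ... | tri≈ _ i≡j _ = contradiction (Fin.toℕ-injective i≡j) i≢j
    ... | tri< i<j _ _
      rewrite lower {suc j} {suc i} (ℕ.m≤n⇒m≤1+n i<j)
        | lower {inject₁ j} {suc i} (subst (suc (toℕ i) ≤_) (sym (toℕ-inject₁ j)) i<j)
        | lower {suc j} {inject₁ i} (ℕ.≤-trans (≤suc i) (ℕ.m≤n⇒m≤1+n i<j))
        | lower {inject₁ j} {inject₁ i} (ℕ.≤-trans (≤suc i) (subst (suc (toℕ i) ≤_) (sym (toℕ-inject₁ j)) i<j)) =
      solve 4 (λ a b c e → (a :- c) :- (b :- c) :- ((a :- e) :- (b :- e)) := con 0ℤ) refl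
        (h (suc j)) (h (inject₁ j)) (l (suc i)) (l (inject₁ i))
    ... | tri> _ _ j<i
      rewrite upper {suc j} {suc i} (ℕ.m≤n⇒m≤1+n j<i)
        | upper {suc j} {inject₁ i} (subst (suc (toℕ j) ≤_) (sym (toℕ-inject₁ i)) j<i)
        | upper {inject₁ j} {suc i} (ℕ.≤-trans (≤suc j) (ℕ.m≤n⇒m≤1+n j<i))
        | upper {inject₁ j} {inject₁ i} (ℕ.≤-trans (≤suc j) (subst (suc (toℕ j) ≤_) (sym (toℕ-inject₁ i)) j<i)) =
      solve 4 (λ a b c e → (a :- c) :- (a :- e) :- ((b :- c) :- (b :- e)) := con 0ℤ) refl
        (h (suc i)) (h (inject₁ i)) (l (suc j)) (l (inject₁ j))

-- Steiner distances on a path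

-- A half-open interval, defined by recursion so that its size follows by the same recursion. It
-- serves for vertices and for edges.
range : ∀ n → ℕ → ℕ → Subset n
range zero    a       b       = []
range (suc n) a       zero    = outside ∷ range n a zero
range (suc n) zero    (suc b) = inside ∷ range n zero b
range (suc n) (suc a) (suc b) = outside ∷ range n a b

∈-range⁺ : ∀ {a b} {x : Fin n} → a ≤ toℕ x → toℕ x < b → x ∈ range n a b
∈-range⁺ {suc n} {zero}  {suc b} {zero}  _         _         = here
∈-range⁺ {suc n} {zero}  {suc b} {suc x} _         (s≤s x<b) = there (∈-range⁺ z≤n x<b)
∈-range⁺ {suc n} {suc a} {suc b} {suc x} (s≤s a≤x) (s≤s x<b) = there (∈-range⁺ a≤x x<b)

∈-range⁻ : ∀ {a b} {x : Fin n} → x ∈ range n a b → a ≤ toℕ x × toℕ x < b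
∈-range⁻ {suc n} {a}     {zero}  {suc x} (there x∈) with () ← proj₂ (∈-range⁻ {n} x∈)
∈-range⁻ {suc n} {zero}  {suc b} {zero}  _          = z≤n , s≤s z≤n
∈-range⁻ {suc n} {zero}  {suc b} {suc x} (there x∈) = z≤n , s≤s (proj₂ (∈-range⁻ {n} x∈))
∈-range⁻ {suc n} {suc a} {suc b} {suc x} (there x∈) = s≤s (proj₁ (∈-range⁻ x∈)) , s≤s (proj₂ (∈-range⁻ {n} x∈))

∣range∣ : ∀ n a {b} → b ≤ n → ∣ range n a b ∣ ≡ b ∸ a
∣range∣ zero    a       z≤n       = sym (ℕ.0∸n≡0 a)
∣range∣ (suc n) a       z≤n       = ∣range∣ n a z≤n
∣range∣ (suc n) zero    (s≤s b≤n) = cong suc (∣range∣ n zero b≤n)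
∣range∣ (suc n) (suc a) (s≤s b≤n) = ∣range∣ n a b≤n

-- Edge `x` is the only one between the vertices up to `x` and those beyond, so the step at which
-- the walk first passes `x` uses it.
crossing : ∀ {E : Subset m} {u v} → Star (AdjacentIn (pathGraph (suc m)) E) u v →
  ∀ x → toℕ u ≤ toℕ x → toℕ x < toℕ v → x ∈ E
crossing ε x u≤x x<u = contradiction x<u (ℕ.≤⇒≯ u≤x)
crossing (_◅_ {j = w} (y , y∈E , joins) p) x u≤x x<v with toℕ w ℕ.≤? toℕ x
... | yes w≤x = crossing p x w≤x x<v
crossing ((y , y∈E , inj₁ (refl , refl)) ◅ p) x u≤x x<v | no w≰x =
  subst (_∈ _) (toℕ-injective (ℕ.≤-antisym
    (subst (_≤ toℕ x) (toℕ-inject₁ y) u≤x) (ℕ.≤-pred (ℕ.≰⇒> w≰x)))) y∈E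
-- A step to the left ends below its start and cannot pass `x`.
crossing ((y , y∈E , inj₂ (refl , refl)) ◅ p) x u≤x x<v | no w≰x =
  contradiction (subst (_≤ toℕ x) (sym (toℕ-inject₁ y)) (ℕ.≤-trans (ℕ.n≤1+n _) u≤x)) w≰x

module _ {a b : ℕ} where

  -- The recursion peels off the last edge, which matching the end vertex as `suc x` exposes as `x`.
  walk : ∀ d {u v : Fin (suc m)} → toℕ v ≡ d + toℕ u → a ≤ toℕ u → toℕ v ≤ b →
    Star (AdjacentIn (pathGraph (suc m)) (range m a b)) u v
  walk zero    v≡u a≤u v≤b with refl ← toℕ-injective v≡u = ε
  walk (suc d) {u} {suc x} v≡ a≤u v≤b =
    walk d x≡ a≤u (subst (_≤ b) (sym (toℕ-inject₁ x)) (ℕ.≤-trans (ℕ.n≤1+n _) v≤b))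
    ◅◅ (x , ∈-range⁺ (ℕ.≤-trans a≤u (subst (toℕ u ≤_) (sym (ℕ.suc-injective v≡)) (ℕ.m≤n+m _ d))) v≤b , inj₁ (refl , refl)) ◅ ε
    where
    x≡ : toℕ (inject₁ x) ≡ d + toℕ u
    x≡ = trans (toℕ-inject₁ x) (ℕ.suc-injective v≡)

  -- Edge `x` joins the vertices at positions `x` and `x + 1`, so the vertices run one position
  -- further than the edges: `suc b` against `b`.
  range-subtree : IsSubtree (P (suc m)) (range (suc m) a (suc b)) (range m a b)
  range-subtree {m} = subgraph , connected
    where
    subgraph : IsSubgraph (pathGraph (suc m)) (range (suc m) a (suc b)) (range m a b)
    subgraph x x∈ with ∈-range⁻ x∈
    ... | a≤x , x<b =
      ∈-range⁺ (subst (a ≤_) (sym (toℕ-inject₁ x)) a≤x) (subst (_< suc b) (sym (toℕ-inject₁ x)) (ℕ.m<n⇒m<1+n x<b)) ,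
      ∈-range⁺ (ℕ.m≤n⇒m≤1+n a≤x) (s≤s x<b)
    connected : Connected (pathGraph (suc m)) (range (suc m) a (suc b)) (range m a b)
    connected u v u∈ v∈ with ∈-range⁻ u∈ | ∈-range⁻ v∈ | ℕ.≤-total (toℕ u) (toℕ v)
    ... | a≤u , _ | _ , v≤b | inj₁ u≤v = walk (toℕ v ∸ toℕ u) (sym (ℕ.m∸n+n≡m u≤v)) a≤u (ℕ.≤-pred v≤b)
    ... | _ , u≤b | a≤v , _ | inj₂ v≤u = reverse (λ (x , x∈ , j) → x , x∈ , swap j)
      (walk (toℕ u ∸ toℕ v) (sym (ℕ.m∸n+n≡m v≤u)) a≤v (ℕ.≤-pred u≤b))

-- The interval from `u` to `v` attains the value. Conversely, by `crossing`, a connected subgraph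
-- containing `u` and `v` has every edge between them.
steinerDistance-path : ∀ {S : Subset (suc m)} {u v} → u ∈ S → v ∈ S →
  (∀ {w} → w ∈ S → toℕ u ≤ toℕ w × toℕ w ≤ toℕ v) →
  steinerDistance (P (suc m)) S ≡ toℕ v ∸ toℕ u
steinerDistance-path {m} {S} {u} {v} u∈S v∈S bounds with steiner (P (suc m)) S
... | d , (V , E , (_ , connected) , S⊆V , ∣E∣≡d) , minimal = ℕ.≤-antisym upper lower
  where
  v≤m : toℕ v ≤ m
  v≤m = ℕ.≤-pred (toℕ<n v)
  upper : d ≤ toℕ v ∸ toℕ u
  upper = minimal (toℕ v ∸ toℕ u)
    ( range (suc m) (toℕ u) (suc (toℕ v)) , range m (toℕ u) (toℕ v) , range-subtree
    , (λ w∈S → ∈-range⁺ (proj₁ (bounds w∈S)) (s≤s (proj₂ (bounds w∈S)))) , ∣range∣ m (toℕ u) v≤m )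
  range⊆E : range m (toℕ u) (toℕ v) ⊆ E
  range⊆E {x} x∈ = crossing (connected u v (S⊆V u∈S) (S⊆V v∈S)) x (proj₁ (∈-range⁻ x∈)) (proj₂ (∈-range⁻ x∈))
  lower : toℕ v ∸ toℕ u ≤ d
  lower = ℕ.≤-trans (ℕ.≤-reflexive (sym (∣range∣ m (toℕ u) v≤m)))
    (ℕ.≤-trans (p⊆q⇒∣p∣≤∣q∣ range⊆E) (ℕ.≤-reflexive ∣E∣≡d))

-- Spans of the members of `B`

∈-set⁻ : (α : 𝒱₂ n) → ∀ {w} → w ∈ set α → w ≡ lo α ⊎ w ≡ hi α
∈-set⁻ α w∈ with x∈p∪q⁻ ⁅ lo α ⁆ ⁅ hi α ⁆ w∈
... | inj₁ w∈lo = inj₁ (x∈⁅y⁆⇒x≡y (lo α) w∈lo)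
... | inj₂ w∈hi = inj₂ (x∈⁅y⁆⇒x≡y (hi α) w∈hi)

lo∈set : (α : 𝒱₂ n) → lo α ∈ set α
lo∈set α = x∈p∪q⁺ (inj₁ (x∈⁅x⁆ (lo α)))

hi∈set : (α : 𝒱₂ n) → hi α ∈ set α
hi∈set α = x∈p∪q⁺ (inj₂ (x∈⁅x⁆ (hi α)))

-- `Q` takes the position as a natural number, so that the recursion can absorb the two skipped
-- positions into `Q`.
interleave-elim : ∀ {A : Set} (Q : A → ℕ → Set) {m} {x : Vector A (suc m)} {y : Vector A m} →
  (∀ i → Q (x i) (toℕ i * 2)) → (∀ j → Q (y j) (suc (toℕ j * 2))) →
  ∀ t → Q (interleave x y t) (toℕ t)
interleave-elim Q         qx qy zero          = qx zero
interleave-elim Q {suc m} qx qy (suc zero)    = qy zero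
interleave-elim Q {suc m} qx qy (suc (suc t)) =
  interleave-elim (λ a t → Q a (suc (suc t))) (qx ∘ suc) (qy ∘ suc) t

⌊2n/2⌋ : ∀ n → ⌊ n * 2 /2⌋ ≡ n
⌊2n/2⌋ zero    = refl
⌊2n/2⌋ (suc n) = cong suc (⌊2n/2⌋ n)

⌈2n/2⌉ : ∀ n → ⌈ n * 2 /2⌉ ≡ n
⌈2n/2⌉ zero    = refl
⌈2n/2⌉ (suc n) = cong suc (⌈2n/2⌉ n)

-- Both end points increase weakly along B, so the span of two members is
-- governed by their positions.
B-ends : ∀ m t → toℕ (lo (B (suc (suc m)) t)) ≡ ⌊ toℕ t /2⌋ × toℕ (hi (B (suc (suc m)) t)) ≡ suc ⌈ toℕ t /2⌉
B-ends m = interleave-elim (λ α t → toℕ (lo α) ≡ ⌊ t /2⌋ × toℕ (hi α) ≡ suc ⌈ t /2⌉)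
  (λ i → trans (toℕ-inject₁ i) (sym (⌊2n/2⌋ (toℕ i))) , cong suc (sym (⌈2n/2⌉ (toℕ i))))
  (λ j → trans (toℕ-inject₁ (inject₁ j)) (trans (toℕ-inject₁ j) (sym (⌈2n/2⌉ (toℕ j))))
       , cong (λ x → suc (suc x)) (sym (⌊2n/2⌋ (toℕ j))))

-- The ends of the member at position `t`, defined on all of `ℕ` so that they compose with any list
-- of positions. They run 0, 0, 1, 1, ... and 1, 2, 2, 3, ...: each step moves exactly one end.
bottom top : ℕ → ℤ
bottom t = + ⌊ t /2⌋
top    t = + suc ⌈ t /2⌉

module _ (m : ℕ) where

  private
    N : ℕ
    N = suc (suc m)
    β : Vector (𝒱₂ N) (suc (m * 2))
    β = B N

  lo-mono : ∀ {s t} → toℕ s ≤ toℕ t → toℕ (lo (β s)) ≤ toℕ (lo (β t))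
  lo-mono {s} {t} s≤t = subst₂ _≤_ (sym (proj₁ (B-ends m s))) (sym (proj₁ (B-ends m t))) (ℕ.⌊n/2⌋-mono s≤t)

  hi-mono : ∀ {s t} → toℕ s ≤ toℕ t → toℕ (hi (β s)) ≤ toℕ (hi (β t))
  hi-mono {s} {t} s≤t = subst₂ _≤_ (sym (proj₂ (B-ends m s))) (sym (proj₂ (B-ends m t))) (s≤s (ℕ.⌈n/2⌉-mono s≤t))

  lo≤hi : ∀ s → toℕ (lo (β s)) ≤ toℕ (hi (β s))
  lo≤hi s = subst₂ _≤_ (sym (proj₁ (B-ends m s))) (sym (proj₂ (B-ends m s))) (ℕ.m≤n⇒m≤1+n (ℕ.⌊n/2⌋≤⌈n/2⌉ (toℕ s)))

  set-bounds : ∀ {s t r} → toℕ s ≤ toℕ r → toℕ r ≤ toℕ t → ∀ {w} → w ∈ set (β r) →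
    toℕ (lo (β s)) ≤ toℕ w × toℕ w ≤ toℕ (hi (β t))
  set-bounds {s} {t} {r} s≤r r≤t w∈ with ∈-set⁻ (β r) w∈
  ... | inj₁ refl = lo-mono s≤r , ℕ.≤-trans (lo≤hi r) (hi-mono r≤t)
  ... | inj₂ refl = ℕ.≤-trans (lo-mono s≤r) (lo≤hi r) , hi-mono r≤t

  gap : ∀ {s t} → toℕ s ≤ toℕ t → + (toℕ (hi (β t)) ∸ toℕ (lo (β s))) ≡ top (toℕ t) ℤ.- bottom (toℕ s)
  gap {s} {t} s≤t = begin
    + (toℕ (hi (β t)) ∸ toℕ (lo (β s)))         ≡⟨ ℤ.⊖-≥ (ℕ.≤-trans (lo-mono s≤t) (lo≤hi t)) ⟨
    toℕ (hi (β t)) ℤ.⊖ toℕ (lo (β s))           ≡⟨ ℤ.m-n≡m⊖n (toℕ (hi (β t))) (toℕ (lo (β s))) ⟨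
    + toℕ (hi (β t)) ℤ.- + toℕ (lo (β s))       ≡⟨ cong₂ (λ x y → + x ℤ.- + y) (proj₂ (B-ends m t)) (proj₁ (B-ends m s)) ⟩
    top (toℕ t) ℤ.- bottom (toℕ s)              ∎
    where open ≡-Reasoning

  -- By monotonicity the union of two members starts at `lo` of the earlier one and ends at `hi` of
  -- the later one.
  𝔇P-isSpan : IsSpan (top ∘ toℕ) (bottom ∘ toℕ) (𝔇P N)
  𝔇P-isSpan = upper , lower
    where
    upper : ∀ {s t} → toℕ s ≤ toℕ t → 𝔇P N s t ≡ top (toℕ t) ℤ.- bottom (toℕ s)
    upper {s} {t} s≤t = trans
      (cong +_ (steinerDistance-path {u = lo (β s)} {hi (β t)} (x∈p∪q⁺ (inj₁ (lo∈set (β s)))) (x∈p∪q⁺ (inj₂ (hi∈set (β t)))) bounds))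
      (gap s≤t)
      where
      bounds : ∀ {w} → w ∈ set (β s) ∪ set (β t) → toℕ (lo (β s)) ≤ toℕ w × toℕ w ≤ toℕ (hi (β t))
      bounds w∈ with x∈p∪q⁻ (set (β s)) (set (β t)) w∈
      ... | inj₁ w∈s = set-bounds ℕ.≤-refl s≤t w∈s
      ... | inj₂ w∈t = set-bounds s≤t ℕ.≤-refl w∈t
    lower : ∀ {s t} → toℕ t ≤ toℕ s → 𝔇P N s t ≡ top (toℕ s) ℤ.- bottom (toℕ t)
    lower {s} {t} t≤s = trans
      (cong +_ (steinerDistance-path {u = lo (β t)} {hi (β s)} (x∈p∪q⁺ (inj₂ (lo∈set (β t)))) (x∈p∪q⁺ (inj₁ (hi∈set (β s)))) bounds))
      (gap t≤s)
      where
      bounds : ∀ {w} → w ∈ set (β s) ∪ set (β t) → toℕ (lo (β t)) ≤ toℕ w × toℕ w ≤ toℕ (hi (β s))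
      bounds w∈ with x∈p∪q⁻ (set (β s)) (set (β t)) w∈
      ... | inj₁ w∈s = set-bounds t≤s ℕ.≤-refl w∈s
      ... | inj₂ w∈t = set-bounds ℕ.≤-refl t≤s w∈t

-- Evaluation of the minors

product-cong : {d d′ : Vector ℤ k} → d ≗ d′ → product d ≡ product d′
product-cong {zero}  d≗ = refl
product-cong {suc k} d≗ = cong₂ ℤ._*_ (d≗ zero) (product-cong (d≗ ∘ suc))

arrow-cong : {x x′ d d′ : Vector ℤ k} → x ≗ x′ → d ≗ d′ → arrow x d ≡ arrow x′ d′
arrow-cong {zero}  x≗ d≗ = refl
arrow-cong {suc k} x≗ d≗ = cong₂ (λ a b → - a ℤ.+ b)
  (cong₂ ℤ._*_ (cong₂ ℤ._*_ (x≗ zero) (x≗ zero)) (product-cong (d≗ ∘ suc)))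
  (cong₂ ℤ._*_ (d≗ zero) (arrow-cong (x≗ ∘ suc) (d≗ ∘ suc)))

-- The diagonal that `det-span` produces when only the positions listed by `g` are kept.
pivots : Vector ℕ (suc k) → Vector ℤ k
pivots g i = - (Δ (top ∘ g) i ℤ.+ Δ (bottom ∘ g) i)

-- The two ingredients of det-span for the submatrix on the rows and columns g 0, g 1, ….
record Value (g : Vector ℕ (suc k)) (p q : ℤ) : Set where
  constructor value
  field
    product≡ : product (pivots g) ≡ p
    arrow≡   : arrow (Δ (top ∘ g)) (pivots g) ≡ q

-- Two positions along `B` raise both ends by one, and only differences of ends enter.
value-shift : {g g′ : Vector ℕ (suc k)} → (∀ i → g′ i ≡ 2 + g i) → ∀ {p q} → Value g p q → Value g′ p q
value-shift {g = g} {g′} g′≡ (value p≡ q≡) = value (trans (product-cong pivots≗) p≡) (trans (arrow-cong top≗ pivots≗) q≡)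
  where
  shift : ∀ a b → (1ℤ ℤ.+ a) ℤ.- (1ℤ ℤ.+ b) ≡ a ℤ.- b
  shift = solve 2 (λ a b → (con 1ℤ :+ a) :- (con 1ℤ :+ b) := a :- b) refl
  top≗ : Δ (top ∘ g′) ≗ Δ (top ∘ g)
  top≗ i rewrite g′≡ (suc i) | g′≡ (inject₁ i) = shift (top (g (suc i))) (top (g (inject₁ i)))
  bottom≗ : Δ (bottom ∘ g′) ≗ Δ (bottom ∘ g)
  bottom≗ i rewrite g′≡ (suc i) | g′≡ (inject₁ i) = shift (bottom (g (suc i))) (bottom (g (inject₁ i)))
  pivots≗ : pivots g′ ≗ pivots g
  pivots≗ i = cong₂ (λ a b → - (a ℤ.+ b)) (top≗ i) (bottom≗ i)

-- One unfolding of `product` and `arrow`, with `x` and `y` the first increments of the two ends.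
value-step : {g : Vector ℕ (suc (suc k))} → ∀ x y {p q} →
  Δ (top ∘ g) zero ≡ x → Δ (bottom ∘ g) zero ≡ y → Value (g ∘ suc) p q →
  Value g (- (x ℤ.+ y) ℤ.* p) (- (x ℤ.* x ℤ.* p) ℤ.+ - (x ℤ.+ y) ℤ.* q)
value-step x y refl refl (value p≡ q≡) = value
  (cong (λ p → - (x ℤ.+ y) ℤ.* p) p≡)
  (cong₂ (λ p q → - (x ℤ.* x ℤ.* p) ℤ.+ - (x ℤ.+ y) ℤ.* q) p≡ q≡)

value-cast : {g : Vector ℕ (suc k)} → ∀ {p q p′ q′} → p ≡ p′ → q ≡ q′ → Value g p q → Value g p′ q′
value-cast refl refl v = v

-- The steps e → f (top moves) and f → e (bottom moves) both have pivot −1.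
value-period : {g : Vector ℕ (suc k)} (g′ : Vector ℕ (suc (suc (suc k)))) →
  g′ zero ≡ 0 → g′ (suc zero) ≡ 1 → (∀ i → g′ (suc (suc i)) ≡ 2 + g i) → g zero ≡ 0 →
  ∀ {p q} → Value g p q → Value g′ p (p ℤ.+ q)
value-period {g = g} g′ g′0 g′1 g′2 g0 {p} {q} v =
  value-cast
    (solve 1 (λ p → con -1ℤ :* (con -1ℤ :* p) := p) refl p)
    (solve 2 (λ p q → :- (con 1ℤ :* con 1ℤ :* (con -1ℤ :* p)) :+ con -1ℤ :* (:- (con 0ℤ :* con 0ℤ :* p) :+ con -1ℤ :* q) := p :+ q) refl p q)
    (value-step 1ℤ 0ℤ (cong₂ (λ a b → top a ℤ.- top b) g′1 g′0) (cong₂ (λ a b → bottom a ℤ.- bottom b) g′1 g′0)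
      (value-step 0ℤ 1ℤ (cong₂ (λ a b → top a ℤ.- top b) g′2≡2 g′1) (cong₂ (λ a b → bottom a ℤ.- bottom b) g′2≡2 g′1)
        (value-shift g′2 v)))
  where
  g′2≡2 : g′ (suc (suc zero)) ≡ 2
  g′2≡2 = trans (g′2 zero) (cong (λ a → 2 + a) g0)

-- All `2m` pivots are -1. Each of the `m` steps e → f has border entry 1 and contributes 1 to
-- `arrow`; the other steps have border entry 0.
value-full : ∀ m → Value {m * 2} toℕ 1ℤ (+ m)
value-full zero    = value refl refl
value-full (suc m) = value-period toℕ refl refl (λ _ → refl) refl (value-full m)

-- Without `e_1` the list opens with a step f → e, of border entry 0 and pivot -1; a shifted full
-- list follows.
value-fromSecond : ∀ m → Value {suc (m * 2)} (suc ∘ toℕ) -1ℤ (- (+ m))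
value-fromSecond m = value-cast refl (trans (ℤ.+-identityˡ _) (ℤ.-1*i≡-i (+ m)))
  (value-step 0ℤ 1ℤ refl refl (value-shift (λ _ → refl) (value-full m)))

-- In the base case only `e_1` and `f_1` remain. Every further period keeps the product -1 and adds
-- it to `arrow`.
value-deleteLast : ∀ k (p : Fin (suc (suc k * 2))) → toℕ p ≡ suc k * 2 →
  Value (toℕ ∘ punchIn p) -1ℤ (- (+ suc k))
value-deleteLast zero    (suc (suc zero))    _  = value refl refl
value-deleteLast (suc k) (suc (suc (suc p))) eq =
  value-period (toℕ ∘ punchIn (suc (suc (suc p)))) refl refl (λ _ → refl) refl
    (value-deleteLast k (suc p) (ℕ.suc-injective (ℕ.suc-injective eq)))

-- Peeling periods brings the deleted position down to 1 or 2. There two steps merge into one that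
-- moves both ends, with border entry 1 and pivot -2.
value-deleteInner : ∀ k (p : Fin (suc (suc k * 2))) → toℕ p ≢ 0 → toℕ p ≢ suc k * 2 →
  Value (toℕ ∘ punchIn p) (- (+ 2)) (- (1ℤ ℤ.+ + 2 ℤ.* + k))
value-deleteInner k       zero                p≢0 _    = contradiction refl p≢0
-- Deleting `f_1` leaves the merged step `e_1` → `e_2`, followed by a shifted full list.
value-deleteInner k       (suc zero)          _   _    = value-cast refl
  (solve 1 (λ x → :- (con 1ℤ :* con 1ℤ :* con 1ℤ) :+ con (- (+ 2)) :* x := :- (con 1ℤ :+ con (+ 2) :* x)) refl (+ k))
  (value-step 1ℤ 1ℤ refl refl (value-shift (λ _ → refl) (value-full k)))
value-deleteInner zero    (suc (suc zero))    _   p≢2  = contradiction refl p≢2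
-- Deleting `e_2` leaves `e_1` → `f_1` and the merged step `f_1` → `f_2`; the rest starts at an f,
-- as in `value-fromSecond`.
value-deleteInner (suc k) (suc (suc zero))    _   _    = value-cast refl
  (solve 1 (λ x → :- (con 1ℤ :* con 1ℤ :* con (+ 2)) :+ con -1ℤ :* (:- (con 1ℤ :* con 1ℤ :* con -1ℤ) :+ con (- (+ 2)) :* (:- x))
     := :- (con 1ℤ :+ con (+ 2) :* (con 1ℤ :+ x))) refl (+ k))
  (value-step 1ℤ 0ℤ refl refl (value-step 1ℤ 1ℤ refl refl (value-shift (λ _ → refl) (value-fromSecond k))))
value-deleteInner (suc k) (suc (suc (suc p))) _   p≢2m = value-cast refl
  (solve 1 (λ x → con (- (+ 2)) :+ (:- (con 1ℤ :+ con (+ 2) :* x)) := :- (con 1ℤ :+ con (+ 2) :* (con 1ℤ :+ x))) refl (+ k))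
  (value-period (toℕ ∘ punchIn (suc (suc (suc p)))) refl refl (λ _ → refl) refl
    (value-deleteInner k (suc p) (λ ()) (p≢2m ∘ cong (λ x → suc (suc x)))))

-- `punchIn p` is monotone, so the submatrix is again a span matrix.
det-deleted : {M : Matrix ℤ (suc (suc k))} → IsSpan (top ∘ toℕ) (bottom ∘ toℕ) M →
  ∀ p {x y} → Value (toℕ ∘ punchIn p) x y →
  det (deleteRowCol p p M) ≡ (top (toℕ (punchIn p zero)) ℤ.- bottom (toℕ (punchIn p zero))) ℤ.* x ℤ.+ y
det-deleted {M = M} (upper , lower) p (value x≡ y≡) = trans
  (det-span {h = top ∘ toℕ ∘ punchIn p} {bottom ∘ toℕ ∘ punchIn p} {deleteRowCol p p M}
    ( (λ {s} {t} s≤t → upper (Fin.punchIn-mono-≤ p s t s≤t))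
    , (λ {s} {t} t≤s → lower (Fin.punchIn-mono-≤ p t s t≤s))))
  (cong₂ (λ x y → (top (toℕ (punchIn p zero)) ℤ.- bottom (toℕ (punchIn p zero))) ℤ.* x ℤ.+ y) x≡ y≡)

det-deleteFirst : ∀ k p → toℕ p ≡ 0 → det (deleteRowCol p p (𝔇P (3 + k))) ≡ - (+ (2 + k))
det-deleteFirst k zero _ = trans (det-deleted (𝔇P-isSpan (suc k)) zero (value-fromSecond k))
  -- The corner is 2, the length of `f_1`, which now comes first.
  (solve 1 (λ x → con (+ 2) :* con -1ℤ :+ (:- x) := :- (con (+ 2) :+ x)) refl (+ k))

det-deleteLast : ∀ k p → toℕ p ≡ suc k * 2 → det (deleteRowCol p p (𝔇P (3 + k))) ≡ - (+ (2 + k))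
-- Matching `p` as `suc _` lets `punchIn p zero` reduce to `zero`; the corner is the length 1 of
-- `e_1`.
det-deleteLast k p@(suc _) eq = trans (det-deleted (𝔇P-isSpan (suc k)) p (value-deleteLast k p eq))
  (solve 1 (λ x → con 1ℤ :* con -1ℤ :+ (:- (con 1ℤ :+ x)) := :- (con (+ 2) :+ x)) refl (+ k))

det-deleteInner : ∀ k p → toℕ p ≢ 0 → toℕ p ≢ suc k * 2 →
  det (deleteRowCol p p (𝔇P (3 + k))) ≡ - (+ (2 * (3 + k) ∸ 3))
det-deleteInner k zero      p≢0 _    = contradiction refl p≢0
det-deleteInner k p@(suc _) p≢0 p≢2m = begin
  det (deleteRowCol p p (𝔇P (3 + k)))               ≡⟨ det-deleted (𝔇P-isSpan (suc k)) p (value-deleteInner k p p≢0 p≢2m) ⟩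
  1ℤ ℤ.* (- (+ 2)) ℤ.+ - (1ℤ ℤ.+ + 2 ℤ.* + k)       ≡⟨ solve 1 (λ x → con 1ℤ :* con (- (+ 2)) :+ (:- (con 1ℤ :+ con (+ 2) :* x)) := :- (con (+ 3) :+ con (+ 2) :* x)) refl (+ k) ⟩
  - (+ 3 ℤ.+ + 2 ℤ.* + k)                           ≡⟨ cong (λ x → - (+ 3 ℤ.+ x)) (ℤ.pos-* 2 k) ⟨
  - (+ (3 + 2 * k))                                 ≡⟨ cong (λ x → - (+ (x ∸ 3))) (ℕ.*-distribˡ-+ 2 3 k) ⟨
  - (+ (2 * (3 + k) ∸ 3))                           ∎
  where open ≡-Reasoning

-- Pendant edges and the ends of `B`

leaf⇒end : ∀ {v : Fin (suc m)} → IsLeaf (pathGraph (suc m)) v → toℕ v ≡ 0 ⊎ toℕ v ≡ m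
leaf⇒end {m}     {zero}  _ = inj₁ refl
leaf⇒end {suc m} {suc v} (_ , _ , unique) with toℕ v ℕ.≟ m
... | yes v≡m = inj₂ (cong suc v≡m)
-- An inner vertex has a neighbour on either side; uniqueness would identify two vertices that are
-- two positions apart.
... | no  v≢m = contradiction (trans (sym (toℕ-inject₁ v)) (trans (cong toℕ left≡right) (cong suc x≡)))
    (ℕ.<⇒≢ (ℕ.m<n⇒m<1+n (ℕ.n<1+n (toℕ v))))
  where
  v<m : suc (toℕ v) < suc m
  v<m = s≤s (ℕ.≤∧≢⇒< (ℕ.≤-pred (toℕ<n v)) v≢m)
  x : Fin (suc m)
  x = Fin.fromℕ< v<m
  x≡ : toℕ x ≡ suc (toℕ v)
  x≡ = Fin.toℕ-fromℕ< v<m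
  left≡right : inject₁ v ≡ suc x
  left≡right = trans
    (sym (unique (v , ∈⊤ , inj₂ (refl , refl))))
    (unique (x , ∈⊤ , inj₁ (toℕ-injective (trans (toℕ-inject₁ x) x≡) , refl)))

last-leaf : ∀ {v : Fin (suc (suc m))} → toℕ v ≡ suc m → IsLeaf (pathGraph (suc (suc m))) v
last-leaf {m} {suc v} v≡ = inject₁ v , (v , ∈⊤ , inj₂ (refl , refl)) , λ where
  (x , _ , inj₁ (x≡v , _)) → contradiction
    (trans (sym (toℕ-inject₁ x)) (trans (cong toℕ x≡v) v≡)) (ℕ.<⇒≢ (toℕ<n x))
  (x , _ , inj₂ (refl , refl)) → refl

first-leaf : IsLeaf (pathGraph (suc (suc m))) zero
first-leaf = suc zero , (zero , ∈⊤ , inj₁ (refl , refl)) , λ where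
  (zero , _ , inj₁ (refl , refl)) → refl

pair-≡ : {α β : 𝒱₂ n} → toℕ (lo α) ≡ toℕ (lo β) → toℕ (hi α) ≡ toℕ (hi β) → α ≡ β
pair-≡ lo≡ hi≡ with refl ← toℕ-injective lo≡ | refl ← toℕ-injective hi≡ = refl

-- A position is the sum of its two halves, which are `lo` and the predecessor of `hi`. For edge `x`
-- both equal `x`, so it sits at position `2x`, and a leaf among its ends makes it the first or the
-- last edge.
pendant⇒end : ∀ k p → IsPendantEdge (pathGraph (3 + k)) (B (3 + k) p) → toℕ p ≡ 0 ⊎ toℕ p ≡ suc k * 2
pendant⇒end k p ((x , ends≡) , leaf) = cases leaf
  where
  lo≡ : toℕ (lo (B (3 + k) p)) ≡ toℕ x
  lo≡ = trans (sym (cong (toℕ ∘ lo) ends≡)) (toℕ-inject₁ x)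
  hi≡ : toℕ (hi (B (3 + k) p)) ≡ suc (toℕ x)
  hi≡ = sym (cong (toℕ ∘ hi) ends≡)
  p≡ : toℕ p ≡ toℕ x * 2
  p≡ = begin
    toℕ p                          ≡⟨ ℕ.⌊n/2⌋+⌈n/2⌉≡n (toℕ p) ⟨
    ⌊ toℕ p /2⌋ + ⌈ toℕ p /2⌉      ≡⟨ cong₂ _+_ (trans (sym (proj₁ (B-ends (suc k) p))) lo≡)
                                       (ℕ.suc-injective (trans (sym (proj₂ (B-ends (suc k) p))) hi≡)) ⟩
    toℕ x + toℕ x                  ≡⟨ cong (λ y → toℕ x + y) (ℕ.+-identityʳ (toℕ x)) ⟨
    2 * toℕ x                      ≡⟨ ℕ.*-comm 2 (toℕ x) ⟩
    toℕ x * 2                      ∎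
    where open ≡-Reasoning
  cases : IsLeaf (pathGraph (3 + k)) (lo (B (3 + k) p)) ⊎ IsLeaf (pathGraph (3 + k)) (hi (B (3 + k) p)) →
    toℕ p ≡ 0 ⊎ toℕ p ≡ suc k * 2
  cases (inj₁ leaf) with leaf⇒end leaf
  ... | inj₁ lo≡0 = inj₁ (trans p≡ (cong (λ x → x * 2) (trans (sym lo≡) lo≡0)))
  ... | inj₂ lo≡m = contradiction (trans (sym lo≡) lo≡m) (ℕ.<⇒≢ (toℕ<n x))
  cases (inj₂ leaf) with leaf⇒end leaf
  ... | inj₁ hi≡0 = contradiction (trans (sym hi≡) hi≡0) λ ()
  ... | inj₂ hi≡m = inj₂ (trans p≡ (cong (λ x → x * 2) (ℕ.suc-injective (trans (sym hi≡) hi≡m))))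

first-pendant : ∀ k p → toℕ p ≡ 0 → IsPendantEdge (pathGraph (3 + k)) (B (3 + k) p)
first-pendant k zero _ = (zero , refl) , inj₁ first-leaf

last-pendant : ∀ k p → toℕ p ≡ suc k * 2 → IsPendantEdge (pathGraph (3 + k)) (B (3 + k) p)
last-pendant k p p≡ = (fromℕ (suc k) , pair-≡ lo≡ hi≡) , inj₂ (last-leaf (trans (sym hi≡) (cong suc (toℕ-fromℕ (suc k)))))
  where
  lo≡ : toℕ (inject₁ (fromℕ (suc k))) ≡ toℕ (lo (B (3 + k) p))
  lo≡ = begin
    toℕ (inject₁ (fromℕ (suc k)))  ≡⟨ toℕ-inject₁ (fromℕ (suc k)) ⟩
    toℕ (fromℕ (suc k))            ≡⟨ toℕ-fromℕ (suc k) ⟩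
    suc k                          ≡⟨ ⌊2n/2⌋ (suc k) ⟨
    ⌊ suc k * 2 /2⌋                ≡⟨ cong ⌊_/2⌋ p≡ ⟨
    ⌊ toℕ p /2⌋                    ≡⟨ proj₁ (B-ends (suc k) p) ⟨
    toℕ (lo (B (3 + k) p))         ∎
    where open ≡-Reasoning
  hi≡ : suc (toℕ (fromℕ (suc k))) ≡ toℕ (hi (B (3 + k) p))
  hi≡ = begin
    suc (toℕ (fromℕ (suc k)))      ≡⟨ cong suc (toℕ-fromℕ (suc k)) ⟩
    suc (suc k)                    ≡⟨ cong suc (⌈2n/2⌉ (suc k)) ⟨
    suc ⌈ suc k * 2 /2⌉            ≡⟨ cong (λ t → suc ⌈ t /2⌉) p≡ ⟨
    suc ⌈ toℕ p /2⌉                ≡⟨ proj₂ (B-ends (suc k) p) ⟨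
    toℕ (hi (B (3 + k) p))         ∎
    where open ≡-Reasoning

theorem5p13 : (k : ℕ) → let n = 3 + k in (i : Fin (suc ((n ∸ 2) * 2))) →
    (IsPendantEdge (pathGraph n) (B n i) → det (deleteRowCol i i (𝔇P n)) ≡ - (+ (n ∸ 1)))
    × (¬ IsPendantEdge (pathGraph n) (B n i) → det (deleteRowCol i i (𝔇P n)) ≡ - (+ (2 * n ∸ 3)))
theorem5p13 k i =
  [ det-deleteFirst k i , det-deleteLast k i ]′ ∘ pendant⇒end k i ,
  λ ¬pendant → det-deleteInner k i (¬pendant ∘ first-pendant k i) (¬pendant ∘ last-pendant k i)
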